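{- Let $A,B\in\mathbb{Q}$ with $AB\neq 0$. (1) There are no trinomials $x^6+Ax^2+B$ of reducibility type $(1,2,3)$. (2) If $x^6+Ax^2+B$ has reducibility type $(2,2,2)$, then either $$(A,B)=\bigl(-s^2-sv-v^2,\,-sv(s+v)\bigr)\quad\text{for some } s,v\in\mathbb{Q},\ sv(s+v)\neq0,$$ with $x^6+Ax^2+B=(x^2+s)(x^2+v)(x^2-s-v)$; or, up to scaling, $$(A,B)=\bigl(-(v-1)(3v-1),\,-v^2(2v-1)\bigr)\quad\text{for some } v\in\mathbb{Q},\ v\neq0,1,\tfrac12,\tfrac13,$$ with $x^6+Ax^2+B=(x^2+x+v)(x^2-x+v)(x^2-2v+1)$.
   Context: A monic polynomial in $\mathbb{Q}[x]$ has reducibility type $(n_1,\dots,n_k)$, $n_1\le\dots\le n_k$, if it factors as a product of $k$ irreducible polynomials in $\mathbb{Q}[x]$ (not necessarily distinct) of degrees $n_1,\dots,n_k$. Trinomials are considered up to scaling: $x^n+Ax^m+B$ and $x^n+A\lambda^{n-m}x^m+B\lambda^n$ are identified for $\lambda\in\mathbb{Q}\setminus\{0\}$; "up to scaling $(A,B)=(A_0,B_0)$" means $(A,B)=(A_0\lambda^{n-m},B_0\lambda^n)$ for some $\lambda\in\mathbb{Q}\setminus\{0\}$ (and the factorization is that of the scaled trinomial). -}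

module Defs where

open import Algebra.Bundles.Raw using (RawRing)
import Algebra.Definitions.RawSemiring as RawSemiringDefs
open import Data.Integer.Base using (+_)
open import Data.List.Base using (List; []; _∷_; map; foldr)
open import Data.List.Relation.Binary.Pointwise using (Pointwise)
open import Data.List.Relation.Unary.All using (All)
open import Data.List.Relation.Unary.Linked using (Linked)
open import Data.Nat.Base as ℕ using (ℕ; zero; suc; _∸_)
open import Data.Product.Base using (_×_; ∃-syntax)
open import Data.Rational.Base using (ℚ; 0ℚ; 1ℚ; _+_; _*_; -_; _/_; +-*-rawSemiring)
open import Level using (0ℓ)
open import Relation.Binary.PropositionalEquality.Core using (_≡_; _≢_)

open RawSemiringDefs +-*-rawSemiring public using () renaming (_^_ to _^ℚ_)

2ℚ 3ℚ ⅓ : ℚ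
2ℚ = + 2 / 1
3ℚ = + 3 / 1
⅓  = + 1 / 3

-- Polynomials are lists of coefficients, constant term first. Trailing zeros
-- are allowed, so equality is _≈ₚ_ rather than _≡_.
Poly : Set
Poly = List ℚ

coeff : Poly → ℕ → ℚ
coeff []      _       = 0ℚ
coeff (a ∷ p) zero    = a
coeff (a ∷ p) (suc n) = coeff p n

infix  4 _≈ₚ_
infix  8 -ₚ_
infixl 7 _*ₚ_
infixl 6 _+ₚ_ _-ₚ_

_≈ₚ_ : Poly → Poly → Set
p ≈ₚ q = ∀ n → coeff p n ≡ coeff q n

const : ℚ → Poly
const a = a ∷ []

X : Poly
X = 0ℚ ∷ 1ℚ ∷ []

_+ₚ_ : Poly → Poly → Poly
[]      +ₚ q       = q
(a ∷ p) +ₚ []      = a ∷ p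
(a ∷ p) +ₚ (b ∷ q) = a + b ∷ p +ₚ q

-ₚ_ : Poly → Poly
-ₚ_ = map (-_)

_-ₚ_ : Poly → Poly → Poly
p -ₚ q = p +ₚ (-ₚ q)

-- (a + x p) q = a q + x (p q)
_*ₚ_ : Poly → Poly → Poly
[]      *ₚ q = []
(a ∷ p) *ₚ q = map (a *_) q +ₚ (0ℚ ∷ p *ₚ q)

ℚ[x] : RawRing 0ℓ 0ℓ
ℚ[x] = record
  { Carrier = Poly
  ; _≈_     = _≈ₚ_
  ; _+_     = _+ₚ_
  ; _*_     = _*ₚ_
  ; -_      = -ₚ_
  ; 0#      = []
  ; 1#      = const 1ℚ
  }

open RawRing ℚ[x] public using () renaming (1# to 1ₚ)
open RawSemiringDefs (RawRing.rawSemiring ℚ[x]) public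
  using (Irreducible) renaming (_^_ to _^ₚ_)

productₚ : List Poly → Poly
productₚ = foldr _*ₚ_ 1ₚ

-- The zero polynomial has no degree.
HasDegree : Poly → ℕ → Set
HasDegree p n = coeff p n ≢ 0ℚ × (∀ m → n ℕ.< m → coeff p m ≡ 0ℚ)

Monic : Poly → Set
Monic p = ∃[ n ] HasDegree p n × coeff p n ≡ 1ℚ

-- The irreducible factors are not required to be monic, only irreducible
-- in ℚ[x]; only their product is monic.
record HasReducibilityType (f : Poly) (ns : List ℕ) : Set where
  field
    monic       : Monic f
    sorted      : Linked ℕ._≤_ ns
    factors     : List Poly
    irreducible : All Irreducible factors
    degrees     : Pointwise HasDegree factors ns
    factorises  : f ≈ₚ productₚ factors

trinomial : ℕ → ℕ → ℚ → ℚ → Poly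
trinomial n m A B = X ^ₚ n +ₚ const A *ₚ X ^ₚ m +ₚ const B

-- (A , B) = (A₀ , B₀) up to scaling, for trinomials xⁿ + A xᵐ + B with m < n.
EqualUpToScaling : (n m : ℕ) (A B A₀ B₀ : ℚ) → Set
EqualUpToScaling n m A B A₀ B₀ =
  ∃[ l ] l ≢ 0ℚ × A ≡ A₀ * l ^ℚ (n ∸ m) × B ≡ B₀ * l ^ℚ n

{-# OPTIONS --safe #-}
-- Part (1): x⁶ + A x² + B is even and B ≠ 0, so the root r of the linear factor gives a second root -r ≠ r,
-- which must be a root of one of the other factors; but an irreducible polynomial of degree ≥ 2 has none.
--
-- Part (2): normalise the factors to x² + aᵢ x + bᵢ. If no aᵢ vanished, the six roots would be ±r, ±s, ±t with
-- r, s, t rational, contradicting r² + s² + t² = 0 (there is no x⁴ term); so, say, a₃ = 0 and a₂ = -a₁. The case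
-- a₁ = 0 gives the first family, and otherwise scaling by a₁ gives the second.
module Submission where

open import Defs
open import Algebra.Bundles.Raw using (RawRing)
import Algebra.Definitions.RawMagma as RawMagma
import Algebra.Definitions.RawSemiring as RawSemiring
open import Algebra.Properties.Group using (x∙y⁻¹≈ε⇒x≈y)
open import Data.Empty using (⊥-elim)
open import Data.List.Base using ([]; _∷_; map)
open import Data.List.Relation.Binary.Pointwise using ([]; _∷_)
open import Data.List.Relation.Unary.All using (_∷_)
open import Data.Nat.Base as ℕ using (ℕ; zero; suc; z≤n; s≤s)
import Data.Nat.Properties as ℕ
open import Data.Product.Base using (_×_; _,_; ∃-syntax; proj₁; proj₂)
open import Data.Rational.Base using (ℚ; 0ℚ; 1ℚ; ½; _+_; _*_; _-_; -_; 1/_; _≤_; ≢-nonZero; nonNegative; nonPositive)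
open import Data.Rational.Properties
open import Data.Sum.Base as Sum using (_⊎_; inj₁; inj₂; [_,_]′)
open import Function.Base using (_∘_)
open import Relation.Binary.PropositionalEquality
open import Relation.Nullary.Decidable.Core using (Dec; yes; no; dec⇒maybe)
open import Relation.Nullary.Negation.Core using (¬_; contradiction)
open import Tactic.RingSolver using (solve-∀)
open import Tactic.RingSolver.Core.AlmostCommutativeRing using (AlmostCommutativeRing; fromCommutativeRing)

open RawSemiring (RawRing.rawSemiring ℚ[x]) using (_∣_)
open ≡-Reasoning

-- The roots `r`, `s`, `t` are rational for this reason: the set of roots is closed under negation,
-- so `x² + a₁ x + b₁` and the reflected factor `x² - a₂ x + b₂` share a root, and their difference
-- is linear with leading coefficient `a₁ + a₂ = - a₃`, which is nonzero. Making this literal would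
-- take a splitting field and a pairing of six roots. Instead the roots are eliminated: they occur
-- only in the search for an identity between the `aᵢ` and `bᵢ` that exhibits a vanishing sum of
-- squares. The order of `ℚ` is essential to that step. Over `ℚ(i)` the triple 3, 4, 5i has square
-- sum zero, and grouping the roots ±3, ±4, ±5i as (3, 4), (-3, 5i), (-4, -5i) gives three
-- quadratics, none with a vanishing linear coefficient.

ℚ-ring : AlmostCommutativeRing _ _
ℚ-ring = fromCommutativeRing +-*-commutativeRing (λ p → dec⇒maybe (0ℚ ≟ p))

-- Arithmetic in ℚ

x-y≡0⇒x≡y : ∀ {x y} → x - y ≡ 0ℚ → x ≡ y
x-y≡0⇒x≡y = x∙y⁻¹≈ε⇒x≈y +-0-group _ _

inverse : ∀ {x} → x ≢ 0ℚ → ∃[ y ] x * y ≡ 1ℚ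
inverse {x} x≢0 = 1/ x , *-inverseʳ x
  where instance _ = ≢-nonZero x≢0

xy≡0⇒x≡0∨y≡0 : ∀ x y → x * y ≡ 0ℚ → x ≡ 0ℚ ⊎ y ≡ 0ℚ
xy≡0⇒x≡0∨y≡0 x y xy≡0 with x ≟ 0ℚ
... | yes x≡0 = inj₁ x≡0
... | no x≢0 with z , xz≡1 ← inverse x≢0 = inj₂ (begin
  y            ≡⟨ *-identityˡ y ⟨
  1ℚ * y       ≡⟨ cong (_* y) xz≡1 ⟨
  x * z * y    ≡⟨ assoc-swap x z y ⟩
  z * (x * y)  ≡⟨ cong (z *_) xy≡0 ⟩
  z * 0ℚ       ≡⟨ *-zeroʳ z ⟩
  0ℚ           ∎)
  where
  assoc-swap : ∀ x z y → x * z * y ≡ z * (x * y)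
  assoc-swap = solve-∀ ℚ-ring

x≢0∧y≢0⇒xy≢0 : ∀ {x y} → x ≢ 0ℚ → y ≢ 0ℚ → x * y ≢ 0ℚ
x≢0∧y≢0⇒xy≢0 x≢0 y≢0 xy≡0 with xy≡0⇒x≡0∨y≡0 _ _ xy≡0
... | inj₁ x≡0 = x≢0 x≡0
... | inj₂ y≡0 = y≢0 y≡0

xy≢0⇒x≢0 : ∀ {x y} → x * y ≢ 0ℚ → x ≢ 0ℚ
xy≢0⇒x≢0 {y = y} xy≢0 x≡0 = xy≢0 (trans (cong (_* y) x≡0) (*-zeroˡ y))

xy≢0⇒y≢0 : ∀ {x y} → x * y ≢ 0ℚ → y ≢ 0ℚ
xy≢0⇒y≢0 {x} xy≢0 y≡0 = xy≢0 (trans (cong (x *_) y≡0) (*-zeroʳ x))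

0≤x² : ∀ x → 0ℚ ≤ x * x
0≤x² x with ≤-total 0ℚ x
... | inj₁ 0≤x = nonNegative⁻¹ (x * x) {{nonNeg*nonNeg⇒nonNeg x {{nonNegative 0≤x}} x {{nonNegative 0≤x}}}}
... | inj₂ x≤0 = nonNegative⁻¹ (x * x) {{nonPos*nonPos⇒nonPos x {{nonPositive x≤0}} x {{nonPositive x≤0}}}}

-- This is where the order of `ℚ` enters. Leaving `y` an arbitrary nonnegative number lets any one
-- term be split off from a longer sum of squares.
x²+y≡0⇒x≡0 : ∀ x {y} → 0ℚ ≤ y → x * x + y ≡ 0ℚ → x ≡ 0ℚ
x²+y≡0⇒x≡0 x {y} 0≤y x²+y≡0 with xy≡0⇒x≡0∨y≡0 x x (≤-antisym x²≤0 (0≤x² x))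
  where
  x²≤0 : x * x ≤ 0ℚ
  x²≤0 = subst₂ _≤_ (+-identityʳ (x * x)) x²+y≡0 (+-monoʳ-≤ (x * x) 0≤y)
... | inj₁ x≡0 = x≡0
... | inj₂ x≡0 = x≡0

0≤x+y : ∀ {x y} → 0ℚ ≤ x → 0ℚ ≤ y → 0ℚ ≤ x + y
0≤x+y 0≤x 0≤y = +-mono-≤ 0≤x 0≤y

-- Polynomials up to coefficientwise equality

∷-cong : ∀ {a b p q} → a ≡ b → p ≈ₚ q → a ∷ p ≈ₚ b ∷ q
∷-cong a≡b p≈q zero    = a≡b
∷-cong a≡b p≈q (suc n) = p≈q n

coeff-+ₚ : ∀ p q n → coeff (p +ₚ q) n ≡ coeff p n + coeff q n
coeff-+ₚ []      q       n       = sym (+-identityˡ (coeff q n))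
coeff-+ₚ (a ∷ p) []      n       = sym (+-identityʳ (coeff (a ∷ p) n))
coeff-+ₚ (a ∷ p) (b ∷ q) zero    = refl
coeff-+ₚ (a ∷ p) (b ∷ q) (suc n) = coeff-+ₚ p q n

coeff-map-* : ∀ a p n → coeff (map (a *_) p) n ≡ a * coeff p n
coeff-map-* a []      n       = sym (*-zeroʳ a)
coeff-map-* a (b ∷ p) zero    = refl
coeff-map-* a (b ∷ p) (suc n) = coeff-map-* a p n

coeff-*ₚ : ∀ a p q n → coeff ((a ∷ p) *ₚ q) n ≡ a * coeff q n + coeff (0ℚ ∷ p *ₚ q) n
coeff-*ₚ a p q n = trans (coeff-+ₚ (map (a *_) q) (0ℚ ∷ p *ₚ q) n)
  (cong (_+ coeff (0ℚ ∷ p *ₚ q) n) (coeff-map-* a q n))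

+ₚ-cong : ∀ p p′ q q′ → p ≈ₚ p′ → q ≈ₚ q′ → p +ₚ q ≈ₚ p′ +ₚ q′
+ₚ-cong p p′ q q′ p≈p′ q≈q′ n =
  trans (coeff-+ₚ p q n) (trans (cong₂ _+_ (p≈p′ n) (q≈q′ n)) (sym (coeff-+ₚ p′ q′ n)))

-- A zero polynomial may be a nonempty list of zeros. This covers the clauses in which two equal
-- polynomials have lists of different lengths.
*ₚ-zeroˡ : ∀ p q → p ≈ₚ [] → p *ₚ q ≈ₚ []
*ₚ-zeroˡ []      q p≈0 n = refl
*ₚ-zeroˡ (a ∷ p) q p≈0 n = begin
  coeff ((a ∷ p) *ₚ q) n                     ≡⟨ coeff-*ₚ a p q n ⟩
  a * coeff q n + coeff (0ℚ ∷ p *ₚ q) n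
    ≡⟨ cong₂ _+_ (trans (cong (_* coeff q n) (p≈0 0)) (*-zeroˡ (coeff q n))) (shifted n) ⟩
  0ℚ                                         ∎
  where
  shifted : 0ℚ ∷ p *ₚ q ≈ₚ []
  shifted zero    = refl
  shifted (suc n) = *ₚ-zeroˡ p q (p≈0 ∘ suc) n

*ₚ-congʳ : ∀ p {q q′} → q ≈ₚ q′ → p *ₚ q ≈ₚ p *ₚ q′
*ₚ-congʳ []      q≈q′ n = refl
*ₚ-congʳ (a ∷ p) {q} {q′} q≈q′ n = begin
  coeff ((a ∷ p) *ₚ q) n                    ≡⟨ coeff-*ₚ a p q n ⟩
  a * coeff q n + coeff (0ℚ ∷ p *ₚ q) n
    ≡⟨ cong₂ _+_ (cong (a *_) (q≈q′ n)) (∷-cong {p = p *ₚ q} refl (*ₚ-congʳ p q≈q′) n) ⟩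
  a * coeff q′ n + coeff (0ℚ ∷ p *ₚ q′) n   ≡⟨ coeff-*ₚ a p q′ n ⟨
  coeff ((a ∷ p) *ₚ q′) n                   ∎

*ₚ-congˡ : ∀ p p′ q → p ≈ₚ p′ → p *ₚ q ≈ₚ p′ *ₚ q
*ₚ-congˡ []      p′       q p≈p′ n = sym (*ₚ-zeroˡ p′ q (sym ∘ p≈p′) n)
*ₚ-congˡ (a ∷ p) []       q p≈p′ n = *ₚ-zeroˡ (a ∷ p) q p≈p′ n
*ₚ-congˡ (a ∷ p) (b ∷ p′) q p≈p′ n = begin
  coeff ((a ∷ p) *ₚ q) n                    ≡⟨ coeff-*ₚ a p q n ⟩
  a * coeff q n + coeff (0ℚ ∷ p *ₚ q) n
    ≡⟨ cong₂ _+_ (cong (_* coeff q n) (p≈p′ 0)) (∷-cong {p = p *ₚ q} refl (*ₚ-congˡ p p′ q (p≈p′ ∘ suc)) n) ⟩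
  b * coeff q n + coeff (0ℚ ∷ p′ *ₚ q) n    ≡⟨ coeff-*ₚ b p′ q n ⟨
  coeff ((b ∷ p′) *ₚ q) n                   ∎

*ₚ-cong : ∀ p p′ q q′ → p ≈ₚ p′ → q ≈ₚ q′ → p *ₚ q ≈ₚ p′ *ₚ q′
*ₚ-cong p p′ q q′ p≈p′ q≈q′ n = trans (*ₚ-congˡ p p′ q p≈p′ n) (*ₚ-congʳ p′ q≈q′ n)

*ₚ-distribʳ-+ₚ : ∀ p q r → (p +ₚ q) *ₚ r ≈ₚ p *ₚ r +ₚ q *ₚ r
*ₚ-distribʳ-+ₚ []      q       r n = refl
*ₚ-distribʳ-+ₚ (a ∷ p) []      r n = sym (trans (coeff-+ₚ ((a ∷ p) *ₚ r) [] n) (+-identityʳ _))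
*ₚ-distribʳ-+ₚ (a ∷ p) (b ∷ q) r n = begin
  coeff ((a + b ∷ p +ₚ q) *ₚ r) n                                                          ≡⟨ coeff-*ₚ (a + b) (p +ₚ q) r n ⟩
  (a + b) * coeff r n + coeff (0ℚ ∷ (p +ₚ q) *ₚ r) n
    ≡⟨ cong ((a + b) * coeff r n +_) (shifted n) ⟩
  (a + b) * coeff r n + (coeff (0ℚ ∷ p *ₚ r) n + coeff (0ℚ ∷ q *ₚ r) n)                    ≡⟨ rearrange a b (coeff r n) _ _ ⟩
  a * coeff r n + coeff (0ℚ ∷ p *ₚ r) n + (b * coeff r n + coeff (0ℚ ∷ q *ₚ r) n)
    ≡⟨ cong₂ _+_ (coeff-*ₚ a p r n) (coeff-*ₚ b q r n) ⟨
  coeff ((a ∷ p) *ₚ r) n + coeff ((b ∷ q) *ₚ r) n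
    ≡⟨ coeff-+ₚ ((a ∷ p) *ₚ r) ((b ∷ q) *ₚ r) n ⟨
  coeff ((a ∷ p) *ₚ r +ₚ (b ∷ q) *ₚ r) n                                                   ∎
  where
  shifted : ∀ n → coeff (0ℚ ∷ (p +ₚ q) *ₚ r) n ≡ coeff (0ℚ ∷ p *ₚ r) n + coeff (0ℚ ∷ q *ₚ r) n
  shifted zero    = refl
  shifted (suc n) = trans (*ₚ-distribʳ-+ₚ p q r n) (coeff-+ₚ (p *ₚ r) (q *ₚ r) n)
  rearrange : ∀ a b x y z → (a + b) * x + (y + z) ≡ a * x + y + (b * x + z)
  rearrange = solve-∀ ℚ-ring

map-*-*ₚ : ∀ a p q → map (a *_) p *ₚ q ≈ₚ map (a *_) (p *ₚ q)
map-*-*ₚ a []      q n = refl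
map-*-*ₚ a (b ∷ p) q n = begin
  coeff ((a * b ∷ map (a *_) p) *ₚ q) n                       ≡⟨ coeff-*ₚ (a * b) (map (a *_) p) q n ⟩
  a * b * coeff q n + coeff (0ℚ ∷ map (a *_) p *ₚ q) n        ≡⟨ cong (a * b * coeff q n +_) (shifted n) ⟩
  a * b * coeff q n + a * coeff (0ℚ ∷ p *ₚ q) n               ≡⟨ factor a b (coeff q n) _ ⟩
  a * (b * coeff q n + coeff (0ℚ ∷ p *ₚ q) n)                 ≡⟨ cong (a *_) (coeff-*ₚ b p q n) ⟨
  a * coeff ((b ∷ p) *ₚ q) n                                  ≡⟨ coeff-map-* a ((b ∷ p) *ₚ q) n ⟨
  coeff (map (a *_) ((b ∷ p) *ₚ q)) n                         ∎
  where
  shifted : ∀ n → coeff (0ℚ ∷ map (a *_) p *ₚ q) n ≡ a * coeff (0ℚ ∷ p *ₚ q) n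
  shifted zero    = sym (*-zeroʳ a)
  shifted (suc n) = trans (map-*-*ₚ a p q n) (coeff-map-* a (p *ₚ q) n)
  factor : ∀ a b x y → a * b * x + a * y ≡ a * (b * x + y)
  factor = solve-∀ ℚ-ring

0∷-*ₚ : ∀ p q → (0ℚ ∷ p) *ₚ q ≈ₚ 0ℚ ∷ p *ₚ q
0∷-*ₚ p q n = trans (coeff-*ₚ 0ℚ p q n) (trans (cong (_+ coeff (0ℚ ∷ p *ₚ q) n) (*-zeroˡ (coeff q n))) (+-identityˡ _))

*ₚ-assoc : ∀ p q r → (p *ₚ q) *ₚ r ≈ₚ p *ₚ (q *ₚ r)
*ₚ-assoc []      q r n = refl
*ₚ-assoc (a ∷ p) q r n = begin
  coeff ((map (a *_) q +ₚ (0ℚ ∷ p *ₚ q)) *ₚ r) n             ≡⟨ *ₚ-distribʳ-+ₚ (map (a *_) q) (0ℚ ∷ p *ₚ q) r n ⟩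
  coeff (map (a *_) q *ₚ r +ₚ (0ℚ ∷ p *ₚ q) *ₚ r) n
    ≡⟨ +ₚ-cong (map (a *_) q *ₚ r) (map (a *_) (q *ₚ r)) ((0ℚ ∷ p *ₚ q) *ₚ r) (0ℚ ∷ p *ₚ (q *ₚ r)) (map-*-*ₚ a q r) shifted n ⟩
  coeff ((a ∷ p) *ₚ (q *ₚ r)) n                              ∎
  where
  shifted : (0ℚ ∷ p *ₚ q) *ₚ r ≈ₚ 0ℚ ∷ p *ₚ (q *ₚ r)
  shifted n = trans (0∷-*ₚ (p *ₚ q) r n) (∷-cong {p = (p *ₚ q) *ₚ r} refl (*ₚ-assoc p q r) n)

-- Evaluation and roots

eval : Poly → ℚ → ℚ
eval []      x = 0ℚ
eval (a ∷ p) x = a + x * eval p x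

eval-zero : ∀ p x → p ≈ₚ [] → eval p x ≡ 0ℚ
eval-zero []      x p≈0 = refl
eval-zero (a ∷ p) x p≈0 = begin
  a + x * eval p x  ≡⟨ cong₂ (λ a y → a + x * y) (p≈0 0) (eval-zero p x (p≈0 ∘ suc)) ⟩
  0ℚ + x * 0ℚ       ≡⟨ trans (+-identityˡ (x * 0ℚ)) (*-zeroʳ x) ⟩
  0ℚ                ∎

eval-cong : ∀ p q x → p ≈ₚ q → eval p x ≡ eval q x
eval-cong []      q       x p≈q = sym (eval-zero q x (sym ∘ p≈q))
eval-cong (a ∷ p) []      x p≈q = eval-zero (a ∷ p) x p≈q
eval-cong (a ∷ p) (b ∷ q) x p≈q = cong₂ (λ a y → a + x * y) (p≈q 0) (eval-cong p q x (p≈q ∘ suc))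

eval-+ₚ : ∀ p q x → eval (p +ₚ q) x ≡ eval p x + eval q x
eval-+ₚ []      q       x = sym (+-identityˡ (eval q x))
eval-+ₚ (a ∷ p) []      x = sym (+-identityʳ (eval (a ∷ p) x))
eval-+ₚ (a ∷ p) (b ∷ q) x =
  trans (cong (λ y → a + b + x * y) (eval-+ₚ p q x)) (rearrange a b x (eval p x) (eval q x))
  where
  rearrange : ∀ a b x y z → a + b + x * (y + z) ≡ a + x * y + (b + x * z)
  rearrange = solve-∀ ℚ-ring

eval-map-* : ∀ a p x → eval (map (a *_) p) x ≡ a * eval p x
eval-map-* a []      x = sym (*-zeroʳ a)
eval-map-* a (b ∷ p) x =
  trans (cong (λ y → a * b + x * y) (eval-map-* a p x)) (rearrange a b x (eval p x))
  where
  rearrange : ∀ a b x y → a * b + x * (a * y) ≡ a * (b + x * y)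
  rearrange = solve-∀ ℚ-ring

eval-*ₚ : ∀ p q x → eval (p *ₚ q) x ≡ eval p x * eval q x
eval-*ₚ []      q x = sym (*-zeroˡ (eval q x))
eval-*ₚ (a ∷ p) q x = begin
  eval (map (a *_) q +ₚ (0ℚ ∷ p *ₚ q)) x              ≡⟨ eval-+ₚ (map (a *_) q) (0ℚ ∷ p *ₚ q) x ⟩
  eval (map (a *_) q) x + (0ℚ + x * eval (p *ₚ q) x)
    ≡⟨ cong₂ (λ y z → y + (0ℚ + x * z)) (eval-map-* a q x) (eval-*ₚ p q x) ⟩
  a * eval q x + (0ℚ + x * (eval p x * eval q x))     ≡⟨ rearrange a x (eval p x) (eval q x) ⟩
  (a + x * eval p x) * eval q x                       ∎
  where
  rearrange : ∀ a x y z → a * z + (0ℚ + x * (y * z)) ≡ (a + x * y) * z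
  rearrange = solve-∀ ℚ-ring

X-const : ℚ → Poly
X-const r = - r ∷ 1ℚ ∷ []

-- Horner's scheme: if `p = (x - r) q + p(r)`, then `a + x p = (x - r) (p(r) + x q) + (a + r
-- p(r))`. The last entry is always `eval [] r`, a harmless trailing zero.
quotient : Poly → ℚ → Poly
quotient []      r = []
quotient (a ∷ p) r = eval p r ∷ quotient p r

coeff-X-const-*ₚ-zero : ∀ r q → coeff (X-const r *ₚ q) 0 ≡ - r * coeff q 0
coeff-X-const-*ₚ-zero r q = trans (coeff-*ₚ (- r) (1ℚ ∷ []) q 0) (+-identityʳ _)

coeff-X-const-*ₚ-suc : ∀ r q n → coeff (X-const r *ₚ q) (suc n) ≡ - r * coeff q (suc n) + coeff q n
coeff-X-const-*ₚ-suc r q n =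
  trans (coeff-*ₚ (- r) (1ℚ ∷ []) q (suc n)) (cong (- r * coeff q (suc n) +_) (begin
    coeff ((1ℚ ∷ []) *ₚ q) n              ≡⟨ coeff-*ₚ 1ℚ [] q n ⟩
    1ℚ * coeff q n + coeff (0ℚ ∷ []) n    ≡⟨ cong₂ _+_ (*-identityˡ (coeff q n)) (0∷[]≈[] n) ⟩
    coeff q n + 0ℚ                        ≡⟨ +-identityʳ (coeff q n) ⟩
    coeff q n                             ∎))
  where
  0∷[]≈[] : 0ℚ ∷ [] ≈ₚ []
  0∷[]≈[] zero    = refl
  0∷[]≈[] (suc n) = refl

division-by-X-const : ∀ p r → p ≈ₚ X-const r *ₚ quotient p r +ₚ const (eval p r)
division-by-X-const []      r zero          = refl
division-by-X-const []      r (suc zero)    = refl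
division-by-X-const []      r (suc (suc n)) = refl
division-by-X-const (a ∷ p) r zero = sym (begin
  coeff (X-const r *ₚ quotient (a ∷ p) r +ₚ const (a + r * e)) 0
    ≡⟨ coeff-+ₚ (X-const r *ₚ quotient (a ∷ p) r) (const (a + r * e)) 0 ⟩
  coeff (X-const r *ₚ quotient (a ∷ p) r) 0 + (a + r * e)
    ≡⟨ cong (_+ (a + r * e)) (coeff-X-const-*ₚ-zero r (quotient (a ∷ p) r)) ⟩
  - r * e + (a + r * e)                                           ≡⟨ identity a r e ⟩
  a                                                               ∎)
  where
  e = eval p r
  identity : ∀ a r e → - r * e + (a + r * e) ≡ a
  identity = solve-∀ ℚ-ring
division-by-X-const (a ∷ p) r (suc n) = begin
  coeff p n                                                   ≡⟨ division-by-X-const p r n ⟩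
  coeff (X-const r *ₚ q +ₚ const e) n                         ≡⟨ coeff-+ₚ (X-const r *ₚ q) (const e) n ⟩
  coeff (X-const r *ₚ q) n + coeff (const e) n                ≡⟨ step n ⟩
  - r * coeff q n + coeff (e ∷ q) n                           ≡⟨ coeff-X-const-*ₚ-suc r (e ∷ q) n ⟨
  coeff (X-const r *ₚ (e ∷ q)) (suc n)                        ≡⟨ +-identityʳ _ ⟨
  coeff (X-const r *ₚ (e ∷ q)) (suc n) + 0ℚ
    ≡⟨ coeff-+ₚ (X-const r *ₚ (e ∷ q)) (const (a + r * e)) (suc n) ⟨
  coeff (X-const r *ₚ (e ∷ q) +ₚ const (a + r * e)) (suc n)   ∎
  where
  e = eval p r
  q = quotient p r
  step : ∀ n → coeff (X-const r *ₚ q) n + coeff (const e) n ≡ - r * coeff q n + coeff (e ∷ q) n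
  step zero    = cong (_+ e) (coeff-X-const-*ₚ-zero r q)
  step (suc n) = trans (+-identityʳ _) (coeff-X-const-*ₚ-suc r q n)

root⇒X-const-divides : ∀ p r → eval p r ≡ 0ℚ → p ≈ₚ X-const r *ₚ quotient p r
root⇒X-const-divides p r pr≡0 n = begin
  coeff p n                                             ≡⟨ division-by-X-const p r n ⟩
  coeff (X-const r *ₚ q +ₚ const (eval p r)) n          ≡⟨ coeff-+ₚ (X-const r *ₚ q) (const (eval p r)) n ⟩
  coeff (X-const r *ₚ q) n + coeff (const (eval p r)) n ≡⟨ cong (coeff (X-const r *ₚ q) n +_) (remainder n) ⟩
  coeff (X-const r *ₚ q) n + 0ℚ                         ≡⟨ +-identityʳ _ ⟩
  coeff (X-const r *ₚ q) n                              ∎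
  where
  q = quotient p r
  remainder : const (eval p r) ≈ₚ []
  remainder zero    = pr≡0
  remainder (suc n) = refl

-- Degrees and units

-- Trailing zeros hide the degree; as equality in `ℚ` is decidable, the last nonzero entry can be
-- searched for from the tail.
zero-or-degree : ∀ p → p ≈ₚ [] ⊎ ∃[ n ] HasDegree p n
zero-or-degree []      = inj₁ λ _ → refl
zero-or-degree (a ∷ p) with zero-or-degree p
... | inj₂ (n , pₙ≢0 , p>n) = inj₂ (suc n , pₙ≢0 , λ { (suc m) (s≤s n<m) → p>n m n<m })
... | inj₁ p≈0 with a ≟ 0ℚ
...   | yes a≡0 = inj₁ λ { zero → a≡0 ; (suc n) → p≈0 n }
...   | no  a≢0 = inj₂ (0 , a≢0 , λ { (suc m) _ → p≈0 m })

-- In the convolution sum at index `m + n` every other term has one index above its bound. Since `m`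
-- and `n` are mere upper bounds, the induction on `p` carries no nonvanishing condition.
leading-coeff-*ₚ : ∀ p q m n → (∀ k → m ℕ.< k → coeff p k ≡ 0ℚ) → (∀ k → n ℕ.< k → coeff q k ≡ 0ℚ) →
  coeff (p *ₚ q) (m ℕ.+ n) ≡ coeff p m * coeff q n
leading-coeff-*ₚ []      q m       n p>m q>n = sym (*-zeroˡ (coeff q n))
leading-coeff-*ₚ (a ∷ p) q zero    n p>m q>n = begin
  coeff ((a ∷ p) *ₚ q) n                 ≡⟨ coeff-*ₚ a p q n ⟩
  a * coeff q n + coeff (0ℚ ∷ p *ₚ q) n  ≡⟨ cong (a * coeff q n +_) (shifted n) ⟩
  a * coeff q n + 0ℚ                     ≡⟨ +-identityʳ _ ⟩
  a * coeff q n                          ∎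
  where
  shifted : 0ℚ ∷ p *ₚ q ≈ₚ []
  shifted zero    = refl
  shifted (suc n) = *ₚ-zeroˡ p q (λ k → p>m (suc k) (s≤s z≤n)) n
leading-coeff-*ₚ (a ∷ p) q (suc m) n p>m q>n = begin
  coeff ((a ∷ p) *ₚ q) (suc (m ℕ.+ n))                       ≡⟨ coeff-*ₚ a p q (suc (m ℕ.+ n)) ⟩
  a * coeff q (suc (m ℕ.+ n)) + coeff (p *ₚ q) (m ℕ.+ n)
    ≡⟨ cong (_+ coeff (p *ₚ q) (m ℕ.+ n)) (trans (cong (a *_) (q>n _ (s≤s (ℕ.m≤n+m n m)))) (*-zeroʳ a)) ⟩
  0ℚ + coeff (p *ₚ q) (m ℕ.+ n)                              ≡⟨ +-identityˡ _ ⟩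
  coeff (p *ₚ q) (m ℕ.+ n)
    ≡⟨ leading-coeff-*ₚ p q m n (λ k m<k → p>m (suc k) (s≤s m<k)) q>n ⟩
  coeff p m * coeff q n                                      ∎

-- Degrees add because `ℚ` has no zero divisors: a nonconstant `p` would give `q *ₚ p` a nonzero
-- coefficient in positive degree, where `1ₚ` has none.
unit⇒const : ∀ p → p ∣ 1ₚ → ∀ n → coeff p (suc n) ≡ 0ℚ
unit⇒const p (q RawMagma., qp≈1) with zero-or-degree q | zero-or-degree p
... | inj₁ q≈0 | _ = ⊥-elim (1≢0 (trans (sym (qp≈1 0)) (*ₚ-zeroˡ q p q≈0 0)))
... | inj₂ _   | inj₁ p≈0 = λ n → p≈0 (suc n)
... | inj₂ _   | inj₂ (zero , _ , p>0) = λ n → p>0 (suc n) (s≤s z≤n)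
... | inj₂ (m , qₘ≢0 , q>m) | inj₂ (suc n , pₙ≢0 , p>n) = ⊥-elim
  (x≢0∧y≢0⇒xy≢0 qₘ≢0 pₙ≢0 (begin
    coeff q m * coeff p (suc n)       ≡⟨ leading-coeff-*ₚ q p m (suc n) q>m p>n ⟨
    coeff (q *ₚ p) (m ℕ.+ suc n)      ≡⟨ cong (coeff (q *ₚ p)) (ℕ.+-suc m n) ⟩
    coeff (q *ₚ p) (suc (m ℕ.+ n))    ≡⟨ qp≈1 (suc (m ℕ.+ n)) ⟩
    0ℚ                                ∎))

-- In `p = (x - r) q` the first factor is no unit, as its `x` coefficient is `1ℚ`; hence `q` is a
-- unit, that is, constant.
irreducible-with-root⇒degree≤1 : ∀ p r → Irreducible p → eval p r ≡ 0ℚ → ∀ n → coeff p (2 ℕ.+ n) ≡ 0ℚ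
irreducible-with-root⇒degree≤1 p r irr pr≡0 n
  with Irreducible.split-∣1 irr {X-const r} {quotient p r} (root⇒X-const-divides p r pr≡0)
... | inj₁ X-r∣1 = ⊥-elim (1≢0 (unit⇒const (X-const r) X-r∣1 0))
... | inj₂ q∣1 = begin
  coeff p (2 ℕ.+ n)                                ≡⟨ root⇒X-const-divides p r pr≡0 (2 ℕ.+ n) ⟩
  coeff (X-const r *ₚ q) (2 ℕ.+ n)                 ≡⟨ coeff-X-const-*ₚ-suc r q (suc n) ⟩
  - r * coeff q (2 ℕ.+ n) + coeff q (suc n)
    ≡⟨ cong₂ (λ y z → - r * y + z) (unit⇒const q q∣1 (suc n)) (unit⇒const q q∣1 n) ⟩
  - r * 0ℚ + 0ℚ                                    ≡⟨ trans (+-identityʳ _) (*-zeroʳ (- r)) ⟩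
  0ℚ                                               ∎
  where q = quotient p r

irreducible⇒no-root : ∀ p r n → Irreducible p → HasDegree p (2 ℕ.+ n) → eval p r ≢ 0ℚ
irreducible⇒no-root p r n irr (pₙ≢0 , _) pr≡0 = pₙ≢0 (irreducible-with-root⇒degree≤1 p r irr pr≡0 n)

*ₚ-identityʳ : ∀ p → p *ₚ 1ₚ ≈ₚ p
*ₚ-identityʳ []      n       = refl
*ₚ-identityʳ (a ∷ p) zero    = trans (+-identityʳ _) (*-identityʳ a)
*ₚ-identityʳ (a ∷ p) (suc n) = begin
  coeff ((a ∷ p) *ₚ 1ₚ) (suc n)   ≡⟨ coeff-*ₚ a p 1ₚ (suc n) ⟩
  a * 0ℚ + coeff (p *ₚ 1ₚ) n      ≡⟨ cong₂ _+_ (*-zeroʳ a) (*ₚ-identityʳ p n) ⟩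
  0ℚ + coeff p n                  ≡⟨ +-identityˡ _ ⟩
  coeff p n                       ∎

-- The trinomial x⁶ + A x² + B and the type (1, 2, 3)

sextic : ℚ → ℚ → Poly
sextic A B = B ∷ 0ℚ ∷ A ∷ 0ℚ ∷ 0ℚ ∷ 0ℚ ∷ 1ℚ ∷ []

trinomial-coefficients : ∀ A B → trinomial 6 2 A B ≈ₚ sextic A B
trinomial-coefficients A B = λ
  { 0 → coeff₀ A B ; 1 → coeff₁ A ; 2 → coeff₂ A ; 3 → refl ; 4 → refl ; 5 → refl ; 6 → refl
  ; (suc (suc (suc (suc (suc (suc (suc n))))))) → refl }
  where
  coeff₀ : ∀ A B → 0ℚ + (A * 0ℚ + 0ℚ) + B ≡ B
  coeff₀ = solve-∀ ℚ-ring
  coeff₁ : ∀ A → 0ℚ + A * 0ℚ ≡ 0ℚ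
  coeff₁ = solve-∀ ℚ-ring
  coeff₂ : ∀ A → 0ℚ + A * 1ℚ ≡ A
  coeff₂ = solve-∀ ℚ-ring

eval-trinomial : ∀ A B x → eval (trinomial 6 2 A B) x ≡ x * x * (x * x * (x * x) + A) + B
eval-trinomial A B x = trans (eval-cong (trinomial 6 2 A B) (sextic A B) x (trinomial-coefficients A B)) (horner A B x)
  where
  horner : ∀ A B x →
    B + x * (0ℚ + x * (A + x * (0ℚ + x * (0ℚ + x * (0ℚ + x * (1ℚ + x * 0ℚ)))))) ≡ x * x * (x * x * (x * x) + A) + B
  horner = solve-∀ ℚ-ring

eval-trinomial-neg : ∀ A B x → eval (trinomial 6 2 A B) (- x) ≡ eval (trinomial 6 2 A B) x
eval-trinomial-neg A B x =
  trans (eval-trinomial A B (- x)) (trans (even A B x) (sym (eval-trinomial A B x)))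
  where
  even : ∀ A B x → (- x) * (- x) * ((- x) * (- x) * ((- x) * (- x)) + A) + B ≡ x * x * (x * x * (x * x) + A) + B
  even = solve-∀ ℚ-ring

eval-trinomial-zero : ∀ A B → eval (trinomial 6 2 A B) 0ℚ ≡ B
eval-trinomial-zero A B = trans (eval-trinomial A B 0ℚ) (constant-term A B)
  where
  constant-term : ∀ A B → 0ℚ * 0ℚ * (0ℚ * 0ℚ * (0ℚ * 0ℚ) + A) + B ≡ B
  constant-term = solve-∀ ℚ-ring

-- The value at every `x` is recorded, not just the root, because the same formula must also show
-- that `- r` is not a root of `p`.
linear-root : ∀ p → HasDegree p 1 → ∃[ r ] (∀ x → eval p x ≡ coeff p 1 * (x - r))
linear-root p (a≢0 , p>1) with y , ay≡1 ← inverse a≢0 = - (y * b) , λ x → begin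
  eval p x                 ≡⟨ eval-cong p (b ∷ a ∷ []) x linear ⟩
  b + x * (a + x * 0ℚ)     ≡⟨ expand a b x ⟩
  1ℚ * b + a * x           ≡⟨ cong (λ u → u * b + a * x) ay≡1 ⟨
  a * y * b + a * x        ≡⟨ collect a b x y ⟩
  a * (x - - (y * b))      ∎
  where
  a = coeff p 1
  b = coeff p 0
  linear : p ≈ₚ b ∷ a ∷ []
  linear zero          = refl
  linear (suc zero)    = refl
  linear (suc (suc n)) = p>1 (2 ℕ.+ n) (s≤s (s≤s z≤n))
  expand : ∀ a b x → b + x * (a + x * 0ℚ) ≡ 1ℚ * b + a * x
  expand = solve-∀ ℚ-ring
  collect : ∀ a b x y → a * y * b + a * x ≡ a * (x - - (y * b))
  collect = solve-∀ ℚ-ring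

no-type-1-2-3 : ∀ A B → B ≢ 0ℚ → ¬ HasReducibilityType (trinomial 6 2 A B) (1 ∷ 2 ∷ 3 ∷ [])
no-type-1-2-3 A B B≢0 record
  { factors     = p ∷ q ∷ h ∷ []
  ; irreducible = _ ∷ q-irreducible ∷ h-irreducible ∷ _
  ; degrees     = p-linear ∷ q-quadratic ∷ h-cubic ∷ []
  ; factorises  = factorises
  } = f[-r]≢0 (trans (eval-trinomial-neg A B r) f[r]≡0)
  where
  f = trinomial 6 2 A B
  a = coeff p 1
  r = proj₁ (linear-root p p-linear)

  eval-p : ∀ x → eval p x ≡ a * (x - r)
  eval-p = proj₂ (linear-root p p-linear)

  eval-f : ∀ x → eval f x ≡ a * (x - r) * (eval q x * eval h x)
  eval-f x = begin
    eval f x                                      ≡⟨ eval-cong f (p *ₚ (q *ₚ (h *ₚ 1ₚ))) x factorises ⟩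
    eval (p *ₚ (q *ₚ (h *ₚ 1ₚ))) x                ≡⟨ eval-*ₚ p (q *ₚ (h *ₚ 1ₚ)) x ⟩
    eval p x * eval (q *ₚ (h *ₚ 1ₚ)) x            ≡⟨ cong (eval p x *_) (eval-*ₚ q (h *ₚ 1ₚ) x) ⟩
    eval p x * (eval q x * eval (h *ₚ 1ₚ) x)
      ≡⟨ cong₂ (λ y z → y * (eval q x * z)) (eval-p x) (eval-cong (h *ₚ 1ₚ) h x (*ₚ-identityʳ h)) ⟩
    a * (x - r) * (eval q x * eval h x)           ∎

  f[r]≡0 : eval f r ≡ 0ℚ
  f[r]≡0 = trans (eval-f r) (vanishes a r (eval q r * eval h r))
    where
    vanishes : ∀ a r y → a * (r - r) * y ≡ 0ℚ
    vanishes = solve-∀ ℚ-ring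

  r≢0 : r ≢ 0ℚ
  r≢0 r≡0 = B≢0 (begin
    B           ≡⟨ eval-trinomial-zero A B ⟨
    eval f 0ℚ   ≡⟨ cong (eval f) r≡0 ⟨
    eval f r    ≡⟨ f[r]≡0 ⟩
    0ℚ          ∎)

  -- This is where characteristic other than 2 matters: it makes `- r` a root different from `r`.
  -r-r≢0 : - r - r ≢ 0ℚ
  -r-r≢0 = x≢0∧y≢0⇒xy≢0 { - 2ℚ } (λ ()) r≢0 ∘ trans (double r)
    where
    double : ∀ r → - 2ℚ * r ≡ - r - r
    double = solve-∀ ℚ-ring

  f[-r]≢0 : eval f (- r) ≢ 0ℚ
  f[-r]≢0 = x≢0∧y≢0⇒xy≢0
    (x≢0∧y≢0⇒xy≢0 (proj₁ p-linear) -r-r≢0)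
    -- The arguments `0` and `1` are the degrees 2 and 3 diminished by two.
    (x≢0∧y≢0⇒xy≢0 (irreducible⇒no-root q (- r) 0 q-irreducible q-quadratic)
                  (irreducible⇒no-root h (- r) 1 h-irreducible h-cubic))
    ∘ trans (sym (eval-f (- r)))

-- Products of three quadratics

quadratic : ℚ → ℚ → ℚ → Poly
quadratic c b a = c ∷ b ∷ a ∷ []

-- Both sides agree by computation except for the `0ℚ` with which `_*ₚ_` shifts each row; it
-- survives as a final summand in the three lowest coefficients.
quadratic*quadratic : ∀ c b a c′ b′ a′ →
  quadratic c b a *ₚ quadratic c′ b′ a′
    ≈ₚ c * c′ ∷ c * b′ + b * c′ ∷ c * a′ + (b * b′ + a * c′) ∷ b * a′ + a * b′ ∷ a * a′ ∷ []
quadratic*quadratic c b a c′ b′ a′ = λ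
  { 0 → +-identityʳ _
  ; 1 → cong (c * b′ +_) (+-identityʳ _)
  ; 2 → cong (λ x → c * a′ + (b * b′ + x)) (+-identityʳ _)
  ; 3 → refl ; 4 → refl
  ; (suc (suc (suc (suc (suc n))))) → refl }

quadratic*quartic : ∀ c b a q₀ q₁ q₂ q₃ q₄ →
  quadratic c b a *ₚ (q₀ ∷ q₁ ∷ q₂ ∷ q₃ ∷ q₄ ∷ [])
    ≈ₚ c * q₀ ∷ c * q₁ + b * q₀ ∷ c * q₂ + (b * q₁ + a * q₀) ∷ c * q₃ + (b * q₂ + a * q₁)
       ∷ c * q₄ + (b * q₃ + a * q₂) ∷ b * q₄ + a * q₃ ∷ a * q₄ ∷ []
quadratic*quartic c b a q₀ q₁ q₂ q₃ q₄ = λ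
  { 0 → +-identityʳ _
  ; 1 → cong (c * q₁ +_) (+-identityʳ _)
  ; 2 → cong (λ x → c * q₂ + (b * q₁ + x)) (+-identityʳ _)
  ; 3 → refl ; 4 → refl ; 5 → refl ; 6 → refl
  ; (suc (suc (suc (suc (suc (suc (suc n))))))) → refl }

-- The coefficients of (x² + a₁ x + b₁) (x² + a₂ x + b₂) (x² + a₃ x + b₃)
monicProduct : (a₁ b₁ a₂ b₂ a₃ b₃ : ℚ) → Poly
monicProduct a₁ b₁ a₂ b₂ a₃ b₃ =
    b₁ * b₂ * b₃
  ∷ a₁ * b₂ * b₃ + a₂ * b₃ * b₁ + a₃ * b₁ * b₂
  ∷ b₁ * b₂ + b₂ * b₃ + b₃ * b₁ + (a₁ * a₂ * b₃ + a₂ * a₃ * b₁ + a₃ * a₁ * b₂)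
  ∷ a₁ * (b₂ + b₃) + a₂ * (b₃ + b₁) + a₃ * (b₁ + b₂) + a₁ * a₂ * a₃
  ∷ b₁ + b₂ + b₃ + (a₁ * a₂ + a₂ * a₃ + a₃ * a₁)
  ∷ a₁ + a₂ + a₃
  ∷ 1ℚ ∷ []

product-of-quadratics : ∀ k₁ a₁ b₁ k₂ a₂ b₂ k₃ a₃ b₃ p q h →
  p ≈ₚ quadratic (k₁ * b₁) (k₁ * a₁) k₁ →
  q ≈ₚ quadratic (k₂ * b₂) (k₂ * a₂) k₂ →
  h ≈ₚ quadratic (k₃ * b₃) (k₃ * a₃) k₃ →
  p *ₚ (q *ₚ h) ≈ₚ map (k₁ * (k₂ * k₃) *_) (monicProduct a₁ b₁ a₂ b₂ a₃ b₃)
product-of-quadratics k₁ a₁ b₁ k₂ a₂ b₂ k₃ a₃ b₃ p q h p≈ q≈ h≈ n = begin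
  coeff (p *ₚ (q *ₚ h)) n                                               ≡⟨ *ₚ-cong p P (q *ₚ h) quartic p≈ qh≈ n ⟩
  coeff (P *ₚ quartic) n
    ≡⟨ quadratic*quartic (k₁ * b₁) (k₁ * a₁) k₁ q₀ q₁ q₂ q₃ q₄ n ⟩
  coeff expanded n                                                      ≡⟨ collect n ⟩
  coeff (map (k₁ * (k₂ * k₃) *_) (monicProduct a₁ b₁ a₂ b₂ a₃ b₃)) n    ∎
  where
  P Q H quartic expanded : Poly
  P = quadratic (k₁ * b₁) (k₁ * a₁) k₁
  Q = quadratic (k₂ * b₂) (k₂ * a₂) k₂
  H = quadratic (k₃ * b₃) (k₃ * a₃) k₃

  q₀ = k₂ * b₂ * (k₃ * b₃)
  q₁ = k₂ * b₂ * (k₃ * a₃) + k₂ * a₂ * (k₃ * b₃)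
  q₂ = k₂ * b₂ * k₃ + (k₂ * a₂ * (k₃ * a₃) + k₂ * (k₃ * b₃))
  q₃ = k₂ * a₂ * k₃ + k₂ * (k₃ * a₃)
  q₄ = k₂ * k₃
  quartic = q₀ ∷ q₁ ∷ q₂ ∷ q₃ ∷ q₄ ∷ []
  expanded = k₁ * b₁ * q₀ ∷ k₁ * b₁ * q₁ + k₁ * a₁ * q₀ ∷ k₁ * b₁ * q₂ + (k₁ * a₁ * q₁ + k₁ * q₀)
    ∷ k₁ * b₁ * q₃ + (k₁ * a₁ * q₂ + k₁ * q₁) ∷ k₁ * b₁ * q₄ + (k₁ * a₁ * q₃ + k₁ * q₂)
    ∷ k₁ * a₁ * q₄ + k₁ * q₃ ∷ k₁ * q₄ ∷ []

  qh≈ : q *ₚ h ≈ₚ quartic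
  qh≈ n = trans (*ₚ-cong q Q h H q≈ h≈ n) (quadratic*quadratic (k₂ * b₂) (k₂ * a₂) k₂ (k₃ * b₃) (k₃ * a₃) k₃ n)

  coeff₀ : ∀ k₁ b₁ k₂ b₂ k₃ b₃ →
    k₁ * b₁ * (k₂ * b₂ * (k₃ * b₃))
      ≡ k₁ * (k₂ * k₃) * (b₁ * b₂ * b₃)
  coeff₀ = solve-∀ ℚ-ring

  coeff₁ : ∀ k₁ a₁ b₁ k₂ a₂ b₂ k₃ a₃ b₃ →
    k₁ * b₁ * (k₂ * b₂ * (k₃ * a₃) + k₂ * a₂ * (k₃ * b₃)) + k₁ * a₁ * (k₂ * b₂ * (k₃ * b₃))
      ≡ k₁ * (k₂ * k₃) * (a₁ * b₂ * b₃ + a₂ * b₃ * b₁ + a₃ * b₁ * b₂)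
  coeff₁ = solve-∀ ℚ-ring

  coeff₂ : ∀ k₁ a₁ b₁ k₂ a₂ b₂ k₃ a₃ b₃ →
    k₁ * b₁ * (k₂ * b₂ * k₃ + (k₂ * a₂ * (k₃ * a₃) + k₂ * (k₃ * b₃)))
      + (k₁ * a₁ * (k₂ * b₂ * (k₃ * a₃) + k₂ * a₂ * (k₃ * b₃)) + k₁ * (k₂ * b₂ * (k₃ * b₃)))
      ≡ k₁ * (k₂ * k₃) * (b₁ * b₂ + b₂ * b₃ + b₃ * b₁ + (a₁ * a₂ * b₃ + a₂ * a₃ * b₁ + a₃ * a₁ * b₂))
  coeff₂ = solve-∀ ℚ-ring

  coeff₃ : ∀ k₁ a₁ b₁ k₂ a₂ b₂ k₃ a₃ b₃ →
    k₁ * b₁ * (k₂ * a₂ * k₃ + k₂ * (k₃ * a₃))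
      + (k₁ * a₁ * (k₂ * b₂ * k₃ + (k₂ * a₂ * (k₃ * a₃) + k₂ * (k₃ * b₃))) + k₁ * (k₂ * b₂ * (k₃ * a₃) + k₂ * a₂ * (k₃ * b₃)))
      ≡ k₁ * (k₂ * k₃) * (a₁ * (b₂ + b₃) + a₂ * (b₃ + b₁) + a₃ * (b₁ + b₂) + a₁ * a₂ * a₃)
  coeff₃ = solve-∀ ℚ-ring

  coeff₄ : ∀ k₁ a₁ b₁ k₂ a₂ b₂ k₃ a₃ b₃ →
    k₁ * b₁ * (k₂ * k₃)
      + (k₁ * a₁ * (k₂ * a₂ * k₃ + k₂ * (k₃ * a₃)) + k₁ * (k₂ * b₂ * k₃ + (k₂ * a₂ * (k₃ * a₃) + k₂ * (k₃ * b₃))))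
      ≡ k₁ * (k₂ * k₃) * (b₁ + b₂ + b₃ + (a₁ * a₂ + a₂ * a₃ + a₃ * a₁))
  coeff₄ = solve-∀ ℚ-ring

  coeff₅ : ∀ k₁ a₁ k₂ a₂ k₃ a₃ →
    k₁ * a₁ * (k₂ * k₃) + k₁ * (k₂ * a₂ * k₃ + k₂ * (k₃ * a₃))
      ≡ k₁ * (k₂ * k₃) * (a₁ + a₂ + a₃)
  coeff₅ = solve-∀ ℚ-ring

  collect : expanded ≈ₚ map (k₁ * (k₂ * k₃) *_) (monicProduct a₁ b₁ a₂ b₂ a₃ b₃)
  collect = λ
    { 0 → coeff₀ k₁ b₁ k₂ b₂ k₃ b₃ ; 1 → coeff₁ k₁ a₁ b₁ k₂ a₂ b₂ k₃ a₃ b₃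
    ; 2 → coeff₂ k₁ a₁ b₁ k₂ a₂ b₂ k₃ a₃ b₃ ; 3 → coeff₃ k₁ a₁ b₁ k₂ a₂ b₂ k₃ a₃ b₃
    ; 4 → coeff₄ k₁ a₁ b₁ k₂ a₂ b₂ k₃ a₃ b₃ ; 5 → coeff₅ k₁ a₁ k₂ a₂ k₃ a₃
    ; 6 → sym (*-identityʳ _)
    ; (suc (suc (suc (suc (suc (suc (suc n))))))) → refl }

-- An inhabitant `F` serves as a system of equations: `F n` compares the coefficients of `xⁿ`, and
-- `F 1`, `F 3`, `F 4`, `F 5` have `0ℚ` on the left.
MonicFactorisation : (A B a₁ b₁ a₂ b₂ a₃ b₃ : ℚ) → Set
MonicFactorisation A B a₁ b₁ a₂ b₂ a₃ b₃ = sextic A B ≈ₚ monicProduct a₁ b₁ a₂ b₂ a₃ b₃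

-- Lets the vanishing linear coefficient be moved to the last place. The sums in `monicProduct` are
-- written cyclically, so that shifting the indices only moves a first term to the end.
rotate : ∀ A B a₁ b₁ a₂ b₂ a₃ b₃ →
  MonicFactorisation A B a₁ b₁ a₂ b₂ a₃ b₃ → MonicFactorisation A B a₂ b₂ a₃ b₃ a₁ b₁
rotate A B a₁ b₁ a₂ b₂ a₃ b₃ F n = trans (F n) (rotated n)
  where
  cycle : ∀ x y z → x + y + z ≡ y + z + x
  cycle = solve-∀ ℚ-ring
  cycle* : ∀ x y z → x * y * z ≡ y * z * x
  cycle* = solve-∀ ℚ-ring
  rotated : monicProduct a₁ b₁ a₂ b₂ a₃ b₃ ≈ₚ monicProduct a₂ b₂ a₃ b₃ a₁ b₁
  rotated = λ
    { 0 → cycle* b₁ b₂ b₃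
    ; 1 → cycle (a₁ * b₂ * b₃) (a₂ * b₃ * b₁) (a₃ * b₁ * b₂)
    ; 2 → cong₂ _+_ (cycle (b₁ * b₂) (b₂ * b₃) (b₃ * b₁)) (cycle (a₁ * a₂ * b₃) (a₂ * a₃ * b₁) (a₃ * a₁ * b₂))
    ; 3 → cong₂ _+_ (cycle (a₁ * (b₂ + b₃)) (a₂ * (b₃ + b₁)) (a₃ * (b₁ + b₂))) (cycle* a₁ a₂ a₃)
    ; 4 → cong₂ _+_ (cycle b₁ b₂ b₃) (cycle (a₁ * a₂) (a₂ * a₃) (a₃ * a₁))
    ; 5 → cycle a₁ a₂ a₃
    ; 6 → refl
    ; (suc (suc (suc (suc (suc (suc (suc n))))))) → refl }

normalised-quadratic : ∀ p → HasDegree p 2 → ∃[ k ] ∃[ a ] ∃[ b ] p ≈ₚ quadratic (k * b) (k * a) k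
normalised-quadratic p (k≢0 , p>2) with k⁻¹ , kk⁻¹≡1 ← inverse k≢0 = k , k⁻¹ * coeff p 1 , k⁻¹ * coeff p 0 , λ
  { 0 → rescale (coeff p 0) ; 1 → rescale (coeff p 1) ; 2 → refl
  ; (suc (suc (suc n))) → p>2 (3 ℕ.+ n) (s≤s (s≤s (s≤s z≤n))) }
  where
  k = coeff p 2
  rescale : ∀ x → x ≡ k * (k⁻¹ * x)
  rescale x = sym (trans (sym (*-assoc k k⁻¹ x)) (trans (cong (_* x) kk⁻¹≡1) (*-identityˡ x)))

-- The given factors may have any leading coefficients `kᵢ`, but the product of these is the
-- coefficient of `x⁶`, so dividing each factor by its own leaves the product unchanged.
type-2-2-2⇒monic-factorisation : ∀ A B → HasReducibilityType (trinomial 6 2 A B) (2 ∷ 2 ∷ 2 ∷ []) →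
  ∃[ a₁ ] ∃[ b₁ ] ∃[ a₂ ] ∃[ b₂ ] ∃[ a₃ ] ∃[ b₃ ] MonicFactorisation A B a₁ b₁ a₂ b₂ a₃ b₃
type-2-2-2⇒monic-factorisation A B record
  { factors    = p ∷ q ∷ h ∷ []
  ; degrees    = p-quadratic ∷ q-quadratic ∷ h-quadratic ∷ []
  ; factorises = factorises
  } with k₁ , a₁ , b₁ , p≈ ← normalised-quadratic p p-quadratic
       | k₂ , a₂ , b₂ , q≈ ← normalised-quadratic q q-quadratic
       | k₃ , a₃ , b₃ , h≈ ← normalised-quadratic h h-quadratic
  = a₁ , b₁ , a₂ , b₂ , a₃ , b₃ , λ n → begin
    coeff (sextic A B) n   ≡⟨ scaled n ⟩
    coeff (map (k *_) M) n ≡⟨ coeff-map-* k M n ⟩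
    k * coeff M n          ≡⟨ cong (_* coeff M n) k≡1 ⟩
    1ℚ * coeff M n         ≡⟨ *-identityˡ _ ⟩
    coeff M n              ∎
  where
  k = k₁ * (k₂ * k₃)
  M = monicProduct a₁ b₁ a₂ b₂ a₃ b₃

  scaled : sextic A B ≈ₚ map (k *_) M
  scaled n = begin
    coeff (sextic A B) n               ≡⟨ trinomial-coefficients A B n ⟨
    coeff (trinomial 6 2 A B) n        ≡⟨ factorises n ⟩
    coeff (p *ₚ (q *ₚ (h *ₚ 1ₚ))) n
      ≡⟨ product-of-quadratics k₁ a₁ b₁ k₂ a₂ b₂ k₃ a₃ b₃ p q (h *ₚ 1ₚ) p≈ q≈ (λ n → trans (*ₚ-identityʳ h n) (h≈ n)) n ⟩
    coeff (map (k *_) M) n             ∎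

  k≡1 : k ≡ 1ℚ
  k≡1 = trans (sym (*-identityʳ k)) (sym (scaled 6))

-- The factors are taken up to `_≈ₚ_` because expressions such as `X ^ₚ 2 +ₚ const s` compute to
-- lists with stray `0ℚ +` terms.
monic-factorisation⇒≈ : ∀ A B a₁ b₁ a₂ b₂ a₃ b₃ → MonicFactorisation A B a₁ b₁ a₂ b₂ a₃ b₃ →
  ∀ p q h → p ≈ₚ quadratic b₁ a₁ 1ℚ → q ≈ₚ quadratic b₂ a₂ 1ℚ → h ≈ₚ quadratic b₃ a₃ 1ℚ →
  trinomial 6 2 A B ≈ₚ p *ₚ q *ₚ h
monic-factorisation⇒≈ A B a₁ b₁ a₂ b₂ a₃ b₃ F p q h p≈ q≈ h≈ n = begin
  coeff (trinomial 6 2 A B) n       ≡⟨ trinomial-coefficients A B n ⟩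
  coeff (sextic A B) n              ≡⟨ F n ⟩
  coeff M n                         ≡⟨ *-identityˡ _ ⟨
  1ℚ * coeff M n                    ≡⟨ coeff-map-* 1ℚ M n ⟨
  coeff (map (1ℚ *_) M) n           ≡⟨ product-of-quadratics 1ℚ a₁ b₁ 1ℚ a₂ b₂ 1ℚ a₃ b₃ p q h
                                         (monic a₁ b₁ p p≈) (monic a₂ b₂ q q≈) (monic a₃ b₃ h h≈) n ⟨
  coeff (p *ₚ (q *ₚ h)) n           ≡⟨ *ₚ-assoc p q h n ⟨
  coeff (p *ₚ q *ₚ h) n             ∎
  where
  M = monicProduct a₁ b₁ a₂ b₂ a₃ b₃
  monic : ∀ a b p → p ≈ₚ quadratic b a 1ℚ → p ≈ₚ quadratic (1ℚ * b) (1ℚ * a) 1ℚ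
  monic a b p p≈ = λ
    { 0 → trans (p≈ 0) (sym (*-identityˡ b)) ; 1 → trans (p≈ 1) (sym (*-identityˡ a)) ; 2 → p≈ 2
    ; (suc (suc (suc n))) → p≈ (3 ℕ.+ n) }

-- The two families

Family₁ Family₂ : ℚ → ℚ → Set
Family₁ A B =
  ∃[ s ] ∃[ v ]
    s * v * (s + v) ≢ 0ℚ
    × A ≡ - (s ^ℚ 2) - s * v - v ^ℚ 2
    × B ≡ - (s * v * (s + v))
    × trinomial 6 2 A B
        ≈ₚ (X ^ₚ 2 +ₚ const s) *ₚ (X ^ₚ 2 +ₚ const v) *ₚ (X ^ₚ 2 -ₚ const s -ₚ const v)
Family₂ A B =
  ∃[ v ] ∃[ A₀ ] ∃[ B₀ ]
    v ≢ 0ℚ × v ≢ 1ℚ × v ≢ ½ × v ≢ ⅓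
    × A₀ ≡ - ((v - 1ℚ) * (3ℚ * v - 1ℚ))
    × B₀ ≡ - (v ^ℚ 2 * (2ℚ * v - 1ℚ))
    × EqualUpToScaling 6 2 A B A₀ B₀
    × trinomial 6 2 A₀ B₀
        ≈ₚ (X ^ₚ 2 +ₚ X +ₚ const v) *ₚ (X ^ₚ 2 -ₚ X +ₚ const v) *ₚ (X ^ₚ 2 -ₚ const (2ℚ * v) +ₚ 1ₚ)

even-factors⇒family₁ : ∀ A B s v w → B ≢ 0ℚ → MonicFactorisation A B 0ℚ s 0ℚ v 0ℚ w → w ≡ - s - v → Family₁ A B
even-factors⇒family₁ A B s v _ B≢0 F refl = s , v , svw≢0 , A≡ , B≡ ,
  monic-factorisation⇒≈ A B 0ℚ s 0ℚ v 0ℚ (- s - v) F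
    (X ^ₚ 2 +ₚ const s) (X ^ₚ 2 +ₚ const v) (X ^ₚ 2 -ₚ const s -ₚ const v)
    (X²+const s) (X²+const v)
    (λ { 0 → cong (_- v) (+-identityˡ (- s)) ; 1 → refl ; 2 → refl ; (suc (suc (suc n))) → refl })
  where
  -- `s * (s * 1ℚ)` is the unfolding of `s ^ℚ 2`, which leaves only ring operations for the solver.
  coeff₂ : ∀ s v →
    s * v + v * (- s - v) + (- s - v) * s + (0ℚ * 0ℚ * (- s - v) + 0ℚ * 0ℚ * s + 0ℚ * 0ℚ * v)
      ≡ - (s * (s * 1ℚ)) - s * v - v * (v * 1ℚ)
  coeff₂ = solve-∀ ℚ-ring
  coeff₀ : ∀ s v → s * v * (- s - v) ≡ - (s * v * (s + v))
  coeff₀ = solve-∀ ℚ-ring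
  A≡ : A ≡ - (s ^ℚ 2) - s * v - v ^ℚ 2
  A≡ = trans (F 2) (coeff₂ s v)
  B≡ : B ≡ - (s * v * (s + v))
  B≡ = trans (F 0) (coeff₀ s v)
  svw≢0 : s * v * (s + v) ≢ 0ℚ
  svw≢0 svw≡0 = B≢0 (trans B≡ (cong -_ svw≡0))
  X²+const : ∀ s → X ^ₚ 2 +ₚ const s ≈ₚ quadratic s 0ℚ 1ℚ
  X²+const s = λ { 0 → +-identityˡ s ; 1 → refl ; 2 → refl ; (suc (suc (suc n))) → refl }

-- With linear coefficients 1, -1, 0 and `b₁ = b₂ = v`, the coefficients of `x⁵`, `x³` and `x`
-- cancel, and that of `x⁴` is `2 v + b₃ - 1`, which dictates the third factor.
family₂-factorisation : ∀ v → MonicFactorisation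
  (- ((v - 1ℚ) * (3ℚ * v - 1ℚ))) (- (v ^ℚ 2 * (2ℚ * v - 1ℚ))) 1ℚ v (- 1ℚ) v 0ℚ (- (2ℚ * v) + 1ℚ)
family₂-factorisation v = λ
  { 0 → coeff₀ v ; 1 → coeff₁ v ; 2 → coeff₂ v ; 3 → coeff₃ v ; 4 → coeff₄ v ; 5 → refl ; 6 → refl
  ; (suc (suc (suc (suc (suc (suc (suc n))))))) → refl }
  where
  coeff₀ : ∀ v → - (v * (v * 1ℚ) * (2ℚ * v - 1ℚ)) ≡ v * v * (- (2ℚ * v) + 1ℚ)
  coeff₀ = solve-∀ ℚ-ring
  coeff₁ : ∀ v → 0ℚ ≡ 1ℚ * v * (- (2ℚ * v) + 1ℚ) + - 1ℚ * (- (2ℚ * v) + 1ℚ) * v + 0ℚ * v * v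
  coeff₁ = solve-∀ ℚ-ring
  coeff₂ : ∀ v → - ((v - 1ℚ) * (3ℚ * v - 1ℚ))
    ≡ v * v + v * (- (2ℚ * v) + 1ℚ) + (- (2ℚ * v) + 1ℚ) * v
      + (1ℚ * - 1ℚ * (- (2ℚ * v) + 1ℚ) + - 1ℚ * 0ℚ * v + 0ℚ * 1ℚ * v)
  coeff₂ = solve-∀ ℚ-ring
  coeff₃ : ∀ v → 0ℚ ≡ 1ℚ * (v + (- (2ℚ * v) + 1ℚ)) + - 1ℚ * (- (2ℚ * v) + 1ℚ + v) + 0ℚ * (v + v) + 1ℚ * - 1ℚ * 0ℚ
  coeff₃ = solve-∀ ℚ-ring
  coeff₄ : ∀ v → 0ℚ ≡ v + v + (- (2ℚ * v) + 1ℚ) + (1ℚ * - 1ℚ + - 1ℚ * 0ℚ + 0ℚ * 1ℚ)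
  coeff₄ = solve-∀ ℚ-ring

scaled-family₂-member : ∀ A B a v → a ≢ 0ℚ → A ≢ 0ℚ → B ≢ 0ℚ →
  A ≡ - ((v - 1ℚ) * (3ℚ * v - 1ℚ)) * a ^ℚ 4 → B ≡ - (v ^ℚ 2 * (2ℚ * v - 1ℚ)) * a ^ℚ 6 → Family₂ A B
scaled-family₂-member A B a v a≢0 A≢0 B≢0 A≡ B≡ =
  v , A₀ v , B₀ v
  -- The excluded values are the zeros of `A₀` (1 and 1/3) and of `B₀` (0 and 1/2); at each of them
  -- the function computes to `0ℚ`.
  , (λ v≡0 → B₀≢0 (cong B₀ v≡0)) , (λ v≡1 → A₀≢0 (cong A₀ v≡1))
  , (λ v≡½ → B₀≢0 (cong B₀ v≡½)) , (λ v≡⅓ → A₀≢0 (cong A₀ v≡⅓))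
  , refl , refl , (a , a≢0 , A≡ , B≡)
  , monic-factorisation⇒≈ (A₀ v) (B₀ v) 1ℚ v (- 1ℚ) v 0ℚ (- (2ℚ * v) + 1ℚ) (family₂-factorisation v)
    (X ^ₚ 2 +ₚ X +ₚ const v) (X ^ₚ 2 -ₚ X +ₚ const v) (X ^ₚ 2 -ₚ const (2ℚ * v) +ₚ 1ₚ)
    (λ { 0 → +-identityˡ v ; 1 → refl ; 2 → refl ; (suc (suc (suc n))) → refl })
    (λ { 0 → +-identityˡ v ; 1 → refl ; 2 → refl ; (suc (suc (suc n))) → refl })
    (λ { 0 → cong (_+ 1ℚ) (+-identityˡ (- (2ℚ * v))) ; 1 → refl ; 2 → refl ; (suc (suc (suc n))) → refl })
  where
  A₀ B₀ : ℚ → ℚ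
  A₀ v = - ((v - 1ℚ) * (3ℚ * v - 1ℚ))
  B₀ v = - (v ^ℚ 2 * (2ℚ * v - 1ℚ))

  A₀≢0 : A₀ v ≢ 0ℚ
  A₀≢0 = xy≢0⇒x≢0 (A≢0 ∘ trans A≡)

  B₀≢0 : B₀ v ≢ 0ℚ
  B₀≢0 = xy≢0⇒x≢0 (B≢0 ∘ trans B≡)

-- The scaling factor is λ = a, which normalises the factor x² + a x + b₁ to x² + x + v.
odd-factor⇒family₂ : ∀ A B a b₁ b₂ b₃ → a ≢ 0ℚ → A ≢ 0ℚ → B ≢ 0ℚ →
  MonicFactorisation A B a b₁ (- a) b₂ 0ℚ b₃ → Family₂ A B
odd-factor⇒family₂ A B a b₁ b₂ b₃ a≢0 A≢0 B≢0 F = member (proj₁ b₁≡va²) F (proj₂ b₁≡va²) (trans b₂≡b₁ (proj₂ b₁≡va²))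
  where
  b₁≡va² : ∃[ v ] b₁ ≡ v * (a * a)
  -- `v` is `b₁ / a²`: under scaling of `x` a linear coefficient has weight one and a constant term
  -- weight two, whence also `a ^ℚ 4` for `A` and `a ^ℚ 6` for `B`.
  b₁≡va² with y , ay≡1 ← inverse a≢0 = b₁ * (y * y) , (begin
    b₁                           ≡⟨ *-identityʳ b₁ ⟨
    b₁ * (1ℚ * 1ℚ)               ≡⟨ cong (λ x → b₁ * (x * x)) ay≡1 ⟨
    b₁ * (a * y * (a * y))       ≡⟨ rearrange b₁ a y ⟩
    b₁ * (y * y) * (a * a)       ∎)
    where
    rearrange : ∀ b a y → b * (a * y * (a * y)) ≡ b * (y * y) * (a * a)
    rearrange = solve-∀ ℚ-ring

  b₂≡b₁ : b₂ ≡ b₁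
  b₂≡b₁ = [ (λ a≡0 → contradiction a≡0 a≢0) , x-y≡0⇒x≡y ]′
    (xy≡0⇒x≡0∨y≡0 a (b₂ - b₁) (trans (x³-coeff a b₁ b₂ b₃) (sym (F 3))))
    where
    x³-coeff : ∀ a b₁ b₂ b₃ →
      a * (b₂ - b₁) ≡ a * (b₂ + b₃) + - a * (b₃ + b₁) + 0ℚ * (b₁ + b₂) + a * - a * 0ℚ
    x³-coeff = solve-∀ ℚ-ring

  normalised : ∀ v → MonicFactorisation A B a (v * (a * a)) (- a) (v * (a * a)) 0ℚ b₃ →
    b₃ ≡ (- (2ℚ * v) + 1ℚ) * (a * a) → Family₂ A B
  normalised v F refl =
    scaled-family₂-member A B a v a≢0 A≢0 B≢0 (trans (F 2) (x²-coeff a v)) (trans (F 0) (x⁰-coeff a v))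
    where
    x²-coeff : ∀ a v →
      v * (a * a) * (v * (a * a)) + v * (a * a) * ((- (2ℚ * v) + 1ℚ) * (a * a)) + (- (2ℚ * v) + 1ℚ) * (a * a) * (v * (a * a))
        + (a * - a * ((- (2ℚ * v) + 1ℚ) * (a * a)) + - a * 0ℚ * (v * (a * a)) + 0ℚ * a * (v * (a * a)))
        ≡ - ((v - 1ℚ) * (3ℚ * v - 1ℚ)) * (a * (a * (a * (a * 1ℚ))))
    x²-coeff = solve-∀ ℚ-ring
    x⁰-coeff : ∀ a v →
      v * (a * a) * (v * (a * a)) * ((- (2ℚ * v) + 1ℚ) * (a * a))
        ≡ - (v * (v * 1ℚ) * (2ℚ * v - 1ℚ)) * (a * (a * (a * (a * (a * (a * 1ℚ))))))
    x⁰-coeff = solve-∀ ℚ-ring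

  -- `b₁` and `b₂` become variables again, so that matching on `refl` substitutes them inside `F`.
  member : ∀ v {b₁ b₂} → MonicFactorisation A B a b₁ (- a) b₂ 0ℚ b₃ →
    b₁ ≡ v * (a * a) → b₂ ≡ v * (a * a) → Family₂ A B
  member v F refl refl = normalised v F (x-y≡0⇒x≡y (trans (x⁴-coeff a v b₃) (sym (F 4))))
    where
    x⁴-coeff : ∀ a v b₃ → b₃ - (- (2ℚ * v) + 1ℚ) * (a * a)
      ≡ v * (a * a) + v * (a * a) + b₃ + (a * - a + - a * 0ℚ + 0ℚ * a)
    x⁴-coeff = solve-∀ ℚ-ring

a₃≡0⇒families : ∀ A B a₁ b₁ a₂ b₂ a₃ b₃ → A ≢ 0ℚ → B ≢ 0ℚ →
  MonicFactorisation A B a₁ b₁ a₂ b₂ a₃ b₃ → a₃ ≡ 0ℚ → Family₁ A B ⊎ Family₂ A B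
a₃≡0⇒families A B a₁ b₁ a₂ b₂ _ b₃ A≢0 B≢0 F refl =
  opposite F (x-y≡0⇒x≡y (trans (x⁵-coeff a₁ a₂) (sym (F 5))))
  where
  x⁵-coeff : ∀ a₁ a₂ → a₂ - - a₁ ≡ a₁ + a₂ + 0ℚ
  x⁵-coeff = solve-∀ ℚ-ring
  x⁴-coeff : ∀ s v w → w - (- s - v) ≡ s + v + w + (0ℚ * 0ℚ + 0ℚ * 0ℚ + 0ℚ * 0ℚ)
  x⁴-coeff = solve-∀ ℚ-ring

  cases : ∀ a → MonicFactorisation A B a b₁ (- a) b₂ 0ℚ b₃ → Dec (a ≡ 0ℚ) → Family₁ A B ⊎ Family₂ A B
  cases _ F (yes refl) = inj₁ (even-factors⇒family₁ A B b₁ b₂ b₃ B≢0 F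
    (x-y≡0⇒x≡y (trans (x⁴-coeff b₁ b₂ b₃) (sym (F 4)))))
  cases a F (no a≢0)   = inj₂ (odd-factor⇒family₂ A B a b₁ b₂ b₃ a≢0 A≢0 B≢0 F)

  opposite : ∀ {a₂} → MonicFactorisation A B a₁ b₁ a₂ b₂ 0ℚ b₃ → a₂ ≡ - a₁ → Family₁ A B ⊎ Family₂ A B
  opposite F refl = cases a₁ F (a₁ ≟ 0ℚ)

-- If the roots of the three factors are {r, s}, {-r, t}, {-s, -t}, then b₁ - b₃ = s (r - t) = s a₂, so the
-- sum of squares below is a₂² (s² + t² + r²); and r² + s² + t² = 0 because there is no x⁴ term.
sum-of-squares : ∀ A B a₁ b₁ b₂ a₃ b₃ → let a₂ = - (a₁ + a₃); u = b₁ - b₃ in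
  MonicFactorisation A B a₁ b₁ a₂ b₂ a₃ b₃ →
  a₁ * a₃ * (u * u + ((u - a₂ * a₃) * (u - a₂ * a₃) + (u + a₁ * a₂) * (u + a₁ * a₂))) ≡ 0ℚ
sum-of-squares A B a₁ b₁ b₂ a₃ b₃ F =
  trans (combination a₁ b₁ b₂ a₃ b₃) (vanishing c₄ c₃ c₁ (F 4) (F 3) (F 1))
  where
  -- Cofactors of the `x⁴`, `x³` and `x` coefficients, with `a₂` eliminated. If `aᵢ` has weight one
  -- and `bᵢ` weight two, the identity is homogeneous of weight six, so the cofactors have weights
  -- 2, 3 and 5 less than six.
  c₄ = - (a₁ * (a₁ + a₃) * (a₁ + a₃) * a₃)
  c₃ = - (a₃ * (3ℚ * (b₁ - b₃) - a₁ * (a₁ + a₃))) - 3ℚ * ((a₁ + a₃) * b₃)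
  c₁ = 3ℚ * (a₁ + a₃)

  -- The factor `a₁ * a₃` cannot be dropped: second-family factorisations with the zero linear
  -- coefficient at index 1 or 3 satisfy the same three equations, yet their squares do not sum to
  -- zero.
  combination : ∀ a₁ b₁ b₂ a₃ b₃ →
    a₁ * a₃ * ((b₁ - b₃) * (b₁ - b₃)
      + ((b₁ - b₃ - - (a₁ + a₃) * a₃) * (b₁ - b₃ - - (a₁ + a₃) * a₃)
      + (b₁ - b₃ + a₁ * - (a₁ + a₃)) * (b₁ - b₃ + a₁ * - (a₁ + a₃))))
    ≡ - (a₁ * (a₁ + a₃) * (a₁ + a₃) * a₃) * (b₁ + b₂ + b₃ + (a₁ * - (a₁ + a₃) + - (a₁ + a₃) * a₃ + a₃ * a₁))
      + (- (a₃ * (3ℚ * (b₁ - b₃) - a₁ * (a₁ + a₃))) - 3ℚ * ((a₁ + a₃) * b₃))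
        * (a₁ * (b₂ + b₃) + - (a₁ + a₃) * (b₃ + b₁) + a₃ * (b₁ + b₂) + a₁ * - (a₁ + a₃) * a₃)
      + 3ℚ * (a₁ + a₃) * (a₁ * b₂ * b₃ + - (a₁ + a₃) * b₃ * b₁ + a₃ * b₁ * b₂)
  combination = solve-∀ ℚ-ring

  vanishing : ∀ c₄ c₃ c₁ {e₄ e₃ e₁} → 0ℚ ≡ e₄ → 0ℚ ≡ e₃ → 0ℚ ≡ e₁ → c₄ * e₄ + c₃ * e₃ + c₁ * e₁ ≡ 0ℚ
  vanishing c₄ c₃ c₁ refl refl refl = zeros c₄ c₃ c₁
    where
    zeros : ∀ x y z → x * 0ℚ + y * 0ℚ + z * 0ℚ ≡ 0ℚ
    zeros = solve-∀ ℚ-ring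

-- Either the factor `a₁ * a₃` in `sum-of-squares` vanishes, or each of its squares does; in the
-- latter case `a₂ * a₃`, a difference of two of the squared terms, is zero.
some-linear-coeff≡0 : ∀ A B a₁ b₁ a₂ b₂ a₃ b₃ → MonicFactorisation A B a₁ b₁ a₂ b₂ a₃ b₃ →
  a₁ ≡ 0ℚ ⊎ a₂ ≡ 0ℚ ⊎ a₃ ≡ 0ℚ
some-linear-coeff≡0 A B a₁ b₁ a₂ b₂ a₃ b₃ F =
  cases F (x-y≡0⇒x≡y (trans (x⁵-coeff a₁ a₂ a₃) (sym (F 5))))
  where
  x⁵-coeff : ∀ a₁ a₂ a₃ → a₂ - - (a₁ + a₃) ≡ a₁ + a₂ + a₃
  x⁵-coeff = solve-∀ ℚ-ring

  from-squares : ∀ a₂ u → u * u + ((u - a₂ * a₃) * (u - a₂ * a₃) + (u + a₁ * a₂) * (u + a₁ * a₂)) ≡ 0ℚ →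
    a₂ ≡ 0ℚ ⊎ a₃ ≡ 0ℚ
  from-squares a₂ u squares≡0 = xy≡0⇒x≡0∨y≡0 a₂ a₃ (begin
    a₂ * a₃              ≡⟨ difference u (a₂ * a₃) ⟩
    u - (u - a₂ * a₃)    ≡⟨ cong₂ _-_ u≡0 u-a₂a₃≡0 ⟩
    0ℚ                   ∎)
    where
    difference : ∀ u x → x ≡ u - (u - x)
    difference = solve-∀ ℚ-ring
    swap : ∀ x y z → y + (x + z) ≡ x + (y + z)
    swap = solve-∀ ℚ-ring
    u≡0 : u ≡ 0ℚ
    u≡0 = x²+y≡0⇒x≡0 u (0≤x+y (0≤x² (u - a₂ * a₃)) (0≤x² (u + a₁ * a₂))) squares≡0
    u-a₂a₃≡0 : u - a₂ * a₃ ≡ 0ℚ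
    u-a₂a₃≡0 = x²+y≡0⇒x≡0 (u - a₂ * a₃) (0≤x+y (0≤x² u) (0≤x² (u + a₁ * a₂)))
      (trans (swap (u * u) ((u - a₂ * a₃) * (u - a₂ * a₃)) ((u + a₁ * a₂) * (u + a₁ * a₂))) squares≡0)

  cases : ∀ {a₂} → MonicFactorisation A B a₁ b₁ a₂ b₂ a₃ b₃ → a₂ ≡ - (a₁ + a₃) → a₁ ≡ 0ℚ ⊎ a₂ ≡ 0ℚ ⊎ a₃ ≡ 0ℚ
  cases F refl =
    [ (λ a₁a₃≡0 → Sum.map₂ inj₂ (xy≡0⇒x≡0∨y≡0 a₁ a₃ a₁a₃≡0))
    , (λ squares≡0 → inj₂ (from-squares (- (a₁ + a₃)) (b₁ - b₃) squares≡0)) ]′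
    (xy≡0⇒x≡0∨y≡0 (a₁ * a₃) _ (sum-of-squares A B a₁ b₁ b₂ a₃ b₃ F))

monic-factorisation⇒families : ∀ A B a₁ b₁ a₂ b₂ a₃ b₃ → A ≢ 0ℚ → B ≢ 0ℚ →
  MonicFactorisation A B a₁ b₁ a₂ b₂ a₃ b₃ → Family₁ A B ⊎ Family₂ A B
monic-factorisation⇒families A B a₁ b₁ a₂ b₂ a₃ b₃ A≢0 B≢0 F =
  cases (some-linear-coeff≡0 A B a₁ b₁ a₂ b₂ a₃ b₃ F)
  where
  F′ : MonicFactorisation A B a₂ b₂ a₃ b₃ a₁ b₁
  F′ = rotate A B a₁ b₁ a₂ b₂ a₃ b₃ F
  F″ : MonicFactorisation A B a₃ b₃ a₁ b₁ a₂ b₂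
  F″ = rotate A B a₂ b₂ a₃ b₃ a₁ b₁ F′

  cases : a₁ ≡ 0ℚ ⊎ a₂ ≡ 0ℚ ⊎ a₃ ≡ 0ℚ → Family₁ A B ⊎ Family₂ A B
  cases (inj₁ a₁≡0)        = a₃≡0⇒families A B a₂ b₂ a₃ b₃ a₁ b₁ A≢0 B≢0 F′ a₁≡0
  cases (inj₂ (inj₁ a₂≡0)) = a₃≡0⇒families A B a₃ b₃ a₁ b₁ a₂ b₂ A≢0 B≢0 F″ a₂≡0
  cases (inj₂ (inj₂ a₃≡0)) = a₃≡0⇒families A B a₁ b₁ a₂ b₂ a₃ b₃ A≢0 B≢0 F a₃≡0

theorem4p3 : (A B : ℚ) → A * B ≢ 0ℚ →
  (¬ HasReducibilityType (trinomial 6 2 A B) (1 ∷ 2 ∷ 3 ∷ []))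
  ×
  (HasReducibilityType (trinomial 6 2 A B) (2 ∷ 2 ∷ 2 ∷ []) →
    (∃[ s ] ∃[ v ]
      s * v * (s + v) ≢ 0ℚ
      × A ≡ - (s ^ℚ 2) - s * v - v ^ℚ 2
      × B ≡ - (s * v * (s + v))
      × trinomial 6 2 A B
          ≈ₚ (X ^ₚ 2 +ₚ const s) *ₚ (X ^ₚ 2 +ₚ const v) *ₚ (X ^ₚ 2 -ₚ const s -ₚ const v))
    ⊎
    (∃[ v ] ∃[ A₀ ] ∃[ B₀ ]
      v ≢ 0ℚ × v ≢ 1ℚ × v ≢ ½ × v ≢ ⅓
      × A₀ ≡ - ((v - 1ℚ) * (3ℚ * v - 1ℚ))
      × B₀ ≡ - (v ^ℚ 2 * (2ℚ * v - 1ℚ))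
      × EqualUpToScaling 6 2 A B A₀ B₀
      × trinomial 6 2 A₀ B₀
          ≈ₚ (X ^ₚ 2 +ₚ X +ₚ const v) *ₚ (X ^ₚ 2 -ₚ X +ₚ const v) *ₚ (X ^ₚ 2 -ₚ const (2ℚ * v) +ₚ 1ₚ)))
theorem4p3 A B AB≢0 = no-type-1-2-3 A B B≢0 , λ type-2-2-2 →
  let a₁ , b₁ , a₂ , b₂ , a₃ , b₃ , F = type-2-2-2⇒monic-factorisation A B type-2-2-2
  in monic-factorisation⇒families A B a₁ b₁ a₂ b₂ a₃ b₃ A≢0 B≢0 F
  where
  A≢0 : A ≢ 0ℚ
  A≢0 = xy≢0⇒x≢0 {A} {B} AB≢0
  B≢0 : B ≢ 0ℚ
  B≢0 = xy≢0⇒y≢0 {A} {B} AB≢0
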